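{- In the VSC, for every term $t\in\Lambda_{\mathsf{vsc}}$ the following three properties are equivalent: - SOL-EX: there exist a full normal form $u$ and a head context $H$ such that $H\langle t\rangle \to_{\mathsf{vsc}}^* u$; - SOL-ID: there exists a head context $H$ such that $H\langle t\rangle\to_{\mathsf{vsc}}^* \mathsf I$, where $\mathsf I=\lambda x.x$; - SOL-FE: for every full normal form $u$ there exists a head context $H_u$ such that $H_u\langle t\rangle \to_{\mathsf{vsc}}^* u$.
   Context: Value substitution calculus (VSC). Terms (the set $\Lambda_{\mathsf{vsc}}$) are $t,u,s ::= v \mid tu \mid t[x{\leftarrow}u]$ and values are $v ::= x \mid \lambda x.t$; $t[x{\leftarrow}u]$ is an explicit substitution (ES), binding $x$ in $t$. Terms are identified up to $\alpha$-renaming; $t\{x{\leftarrow}u\}$ is capture-avoiding (meta-level) substitution. Contexts are terms with exactly one hole $\langle\cdot\rangle$; plugging $C\langle t\rangle$ may capture variables. Substitution contexts: $L ::= \langle\cdot\rangle \mid L[x{\leftarrow}t]$. Root rules: $L\langle\lambda x.t\rangle u \mapsto_{\mathsf m} L\langle t[x{\leftarrow}u]\rangle$ and $t[x{\leftarrow}L\langle v\rangle] \mapsto_{\mathsf e} L\langle t\{x{\leftarrow}v\}\rangle$ with $v$ a value, where (by $\alpha$-renaming) $L$ captures no free variable of $u$, resp. of $t$. Full contexts: $F ::= \langle\cdot\rangle \mid Ft \mid tF \mid \lambda x.F \mid F[x{\leftarrow}t] \mid t[x{\leftarrow}F]$. The reduction $\to_{\mathsf{vsc}}$ is the closure of $\mapsto_{\mathsf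 m}\cup\mapsto_{\mathsf e}$ under full contexts. A full normal form is a $\to_{\mathsf{vsc}}$-normal term. Head contexts: $H ::= \langle\cdot\rangle \mid \lambda x.H \mid Ht$ with $t\in\Lambda_{\mathsf{vsc}}$. -}

module Defs where

open import Data.Bool.Base using (if_then_else_)
open import Data.Nat.Base using (ℕ; zero; suc; _+_)
open import Data.Nat.Properties using (_≟_)
open import Data.Product.Base using (∃-syntax; _×_)
open import Level using (0ℓ)
open import Relation.Binary.Core using (Rel)
open import Relation.Binary.Construct.Closure.ReflexiveTransitive using (Star)
open import Relation.Binary.Construct.Union using (_∪_)
open import Relation.Binary.Rewriting using (IsNormalForm)
open import Relation.Nullary.Decidable.Core using (does)

infixl 9 _[←_]
infixl 8 _·_
infixr 7 ƛ_
infix  4 _↦m_ _↦e_ _→vsc_ _→vsc*_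

-- Terms up to α-renaming, as de Bruijn terms over an infinite supply of
-- variables: an index k not bound inside the term is the free variable named k.
-- Both  ƛ t  and  t [← u ]  bind index 0 in t; u is outside the scope.

data Term : Set where
  var   : ℕ → Term
  ƛ_    : Term → Term
  _·_   : Term → Term → Term
  _[←_] : Term → Term → Term

data Value : Term → Set where
  var : ∀ x → Value (var x)
  ƛ_  : ∀ t → Value (ƛ t)

ext : (ℕ → ℕ) → ℕ → ℕ
ext ρ zero    = zero
ext ρ (suc x) = suc (ρ x)

rename : (ℕ → ℕ) → Term → Term
rename ρ (var x)    = var (ρ x)
rename ρ (ƛ t)      = ƛ rename (ext ρ) t
rename ρ (t · u)    = rename ρ t · rename ρ u
rename ρ (t [← u ]) = rename (ext ρ) t [← rename ρ u ]

exts : (ℕ → Term) → ℕ → Term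
exts σ zero    = var zero
exts σ (suc x) = rename suc (σ x)

subst : (ℕ → Term) → Term → Term
subst σ (var x)    = σ x
subst σ (ƛ t)      = ƛ subst (exts σ) t
subst σ (t · u)    = subst σ t · subst σ u
subst σ (t [← u ]) = subst (exts σ) t [← subst σ u ]

single : Term → ℕ → Term
single u zero    = u
single u (suc x) = var x

-- t{x←u}, where x is index 0 of t.
_⟦_⟧ : Term → Term → Term
t ⟦ u ⟧ = subst (single u) t

data SubCtx : Set where
  ⟨·⟩   : SubCtx
  _[←_] : SubCtx → Term → SubCtx

_⟨_⟩ˢ : SubCtx → Term → Term
⟨·⟩        ⟨ t ⟩ˢ = t
(L [← u ]) ⟨ t ⟩ˢ = L ⟨ t ⟩ˢ [← u ]

-- Number of variables bound at the hole.
depth : SubCtx → ℕ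
depth ⟨·⟩        = 0
depth (L [← _ ]) = suc (depth L)

-- Moving a term under L shifts its free variables by depth L, so that L
-- captures none of them. In _↦e_ the index 0 of t is the variable being
-- substituted and is left in place by the shift.

data _↦m_ : Rel Term 0ℓ where
  mult : ∀ L t u →
         L ⟨ ƛ t ⟩ˢ · u ↦m L ⟨ t [← rename (depth L +_) u ] ⟩ˢ

data _↦e_ : Rel Term 0ℓ where
  expo : ∀ L t {v} → Value v →
         t [← L ⟨ v ⟩ˢ ] ↦e L ⟨ rename (ext (depth L +_)) t ⟦ v ⟧ ⟩ˢ

data FullCtx : Set where
  ⟨·⟩    : FullCtx
  _·ˡ_   : FullCtx → Term → FullCtx
  _·ʳ_   : Term → FullCtx → FullCtx
  ƛ_     : FullCtx → FullCtx
  _[←_]ˡ : FullCtx → Term → FullCtx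
  _[←_]ʳ : Term → FullCtx → FullCtx

_⟨_⟩ᶠ : FullCtx → Term → Term
⟨·⟩         ⟨ t ⟩ᶠ = t
(F ·ˡ u)    ⟨ t ⟩ᶠ = F ⟨ t ⟩ᶠ · u
(u ·ʳ F)    ⟨ t ⟩ᶠ = u · F ⟨ t ⟩ᶠ
(ƛ F)       ⟨ t ⟩ᶠ = ƛ (F ⟨ t ⟩ᶠ)
(F [← u ]ˡ) ⟨ t ⟩ᶠ = F ⟨ t ⟩ᶠ [← u ]
(u [← F ]ʳ) ⟨ t ⟩ᶠ = u [← F ⟨ t ⟩ᶠ ]

data _→vsc_ : Rel Term 0ℓ where
  close : ∀ F {t u} → (_↦m_ ∪ _↦e_) t u → F ⟨ t ⟩ᶠ →vsc F ⟨ u ⟩ᶠ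

_→vsc*_ : Rel Term 0ℓ
_→vsc*_ = Star _→vsc_

FullNormal : Term → Set
FullNormal = IsNormalForm _→vsc_

-- λx.t for the variable named x: the free occurrences of x become index 0, and
-- every other free variable keeps its name (hence its index is shifted by one).

bind : ℕ → ℕ → ℕ
bind x y = if does (y ≟ x) then zero else suc y

abstr : ℕ → Term → Term
abstr x t = ƛ rename (bind x) t

-- Contexts are not taken up to α: the binder in  ƛ x ∙ H  is the name x, which
-- plugging may capture. So, unlike with an index-0 binder, one may abstract any
-- chosen free variable of the plugged term, or none by choosing x not free in it.

data HeadCtx : Set where
  ⟨·⟩  : HeadCtx
  ƛ_∙_ : ℕ → HeadCtx → HeadCtx
  _·_  : HeadCtx → Term → HeadCtx

_⟨_⟩ʰ : HeadCtx → Term → Term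
⟨·⟩       ⟨ t ⟩ʰ = t
(ƛ x ∙ H) ⟨ t ⟩ʰ = abstr x (H ⟨ t ⟩ʰ)
(H · u)   ⟨ t ⟩ʰ = H ⟨ t ⟩ʰ · u

I : Term
I = ƛ var 0

SOL-EX : Term → Set
SOL-EX t = ∃[ u ] ∃[ H ] (FullNormal u × H ⟨ t ⟩ʰ →vsc* u)

SOL-ID : Term → Set
SOL-ID t = ∃[ H ] (H ⟨ t ⟩ʰ →vsc* I)

SOL-FE : Term → Set
SOL-FE t = ∀ u → FullNormal u → ∃[ H ] (H ⟨ t ⟩ʰ →vsc* u)

{-# OPTIONS --safe #-}

-- Only SOL-EX ⇒ SOL-ID needs an argument. Let oₖ = λ…λ.I with k leading dummy
-- abstractions. A full normal form is either an abstraction or a stuck term,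
-- headed by a variable, up to explicit substitutions containing stuck terms.
-- Once every free variable is replaced by some oₖ with k large, a stuck term
-- evaluates to an oⱼ, as each argument is a value and is erased by the head; so
-- every explicit substitution of the normal form fires. The remaining
-- abstraction is then applied to some oₖ, and so on until an oⱼ is reached,
-- which j further arguments turn into I.

module Submission where

open import Defs
open import Data.List.Base using (List; []; _∷_; foldl)
open import Data.Nat.Base using (ℕ; zero; suc; _+_; _⊔_; _≤_; _<_; s≤s)
open import Data.Nat.Properties
  using (_≟_; ≤-refl; ≤-reflexive; ≤-trans; <-≤-trans; <⇒≤; >⇒≢; +-suc; +-assoc; +-monoˡ-≤;
         m≤n+m; m≤m⊔n; m≤n⊔m; m+n≤o⇒m≤o; m<1+n⇒m<n∨m≡n)
open import Data.Product.Base using (∃-syntax; _×_; _,_)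
open import Data.Sum.Base using (inj₁; inj₂)
open import Function.Base using (_∘_)
open import Function.Bundles using (_⇔_; mk⇔)
open import Relation.Binary.Construct.Closure.ReflexiveTransitive using (ε; _◅_; _◅◅_; gmap)
open import Relation.Binary.Construct.Union using (_∪_)
open import Relation.Binary.PropositionalEquality.Core
  using (_≡_; _≢_; refl; sym; trans; cong; cong₂; subst₂) renaming (subst to transport)
open import Relation.Binary.PropositionalEquality.Properties using (module ≡-Reasoning)
open import Relation.Nullary.Decidable using (dec-true; dec-false)
open import Relation.Nullary.Negation.Core using (contradiction)

private
  variable
    k m n : ℕ
    s t t′ u u′ v : Term
    ρ ρ₁ ρ₂ : ℕ → ℕ
    σ τ υ : ℕ → Term

-- Substitution calculus

ext-id : (∀ x → ρ x ≡ x) → ∀ x → ext ρ x ≡ x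
ext-id eq zero    = refl
ext-id eq (suc x) = cong suc (eq x)

rename-id : (∀ x → ρ x ≡ x) → ∀ t → rename ρ t ≡ t
rename-id eq (var x)    = cong var (eq x)
rename-id eq (ƛ t)      = cong ƛ_ (rename-id (ext-id eq) t)
rename-id eq (t · u)    = cong₂ _·_ (rename-id eq t) (rename-id eq u)
rename-id eq (t [← u ]) = cong₂ _[←_] (rename-id (ext-id eq) t) (rename-id eq u)

exts-id : (∀ x → σ x ≡ var x) → ∀ x → exts σ x ≡ var x
exts-id eq zero    = refl
exts-id eq (suc x) = cong (rename suc) (eq x)

subst-id : (∀ x → σ x ≡ var x) → ∀ t → subst σ t ≡ t
subst-id eq (var x)    = eq x
subst-id eq (ƛ t)      = cong ƛ_ (subst-id (exts-id eq) t)
subst-id eq (t · u)    = cong₂ _·_ (subst-id eq t) (subst-id eq u)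
subst-id eq (t [← u ]) = cong₂ _[←_] (subst-id (exts-id eq) t) (subst-id eq u)

-- The composition laws take the pointwise equation as a hypothesis, so that
-- they include congruence and need no function extensionality.

ext-∘ : (∀ x → ρ₂ (ρ₁ x) ≡ ρ x) → ∀ x → ext ρ₂ (ext ρ₁ x) ≡ ext ρ x
ext-∘ eq zero    = refl
ext-∘ eq (suc x) = cong suc (eq x)

rename-∘ : (∀ x → ρ₂ (ρ₁ x) ≡ ρ x) → ∀ t → rename ρ₂ (rename ρ₁ t) ≡ rename ρ t
rename-∘ eq (var x)    = cong var (eq x)
rename-∘ eq (ƛ t)      = cong ƛ_ (rename-∘ (ext-∘ eq) t)
rename-∘ eq (t · u)    = cong₂ _·_ (rename-∘ eq t) (rename-∘ eq u)
rename-∘ eq (t [← u ]) = cong₂ _[←_] (rename-∘ (ext-∘ eq) t) (rename-∘ eq u)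

rename-suc : ∀ t → rename (ext ρ) (rename suc t) ≡ rename suc (rename ρ t)
rename-suc t = trans (rename-∘ (λ _ → refl) t) (sym (rename-∘ (λ _ → refl) t))

exts-ext : (∀ x → σ (ρ x) ≡ τ x) → ∀ x → exts σ (ext ρ x) ≡ exts τ x
exts-ext eq zero    = refl
exts-ext eq (suc x) = cong (rename suc) (eq x)

subst-rename : (∀ x → σ (ρ x) ≡ τ x) → ∀ t → subst σ (rename ρ t) ≡ subst τ t
subst-rename eq (var x)    = eq x
subst-rename eq (ƛ t)      = cong ƛ_ (subst-rename (exts-ext eq) t)
subst-rename eq (t · u)    = cong₂ _·_ (subst-rename eq t) (subst-rename eq u)
subst-rename eq (t [← u ]) = cong₂ _[←_] (subst-rename (exts-ext eq) t) (subst-rename eq u)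

ext-exts : (∀ x → rename ρ (σ x) ≡ τ x) → ∀ x → rename (ext ρ) (exts σ x) ≡ exts τ x
ext-exts         eq zero    = refl
ext-exts {σ = σ} eq (suc x) = trans (rename-suc (σ x)) (cong (rename suc) (eq x))

rename-subst : (∀ x → rename ρ (σ x) ≡ τ x) → ∀ t → rename ρ (subst σ t) ≡ subst τ t
rename-subst eq (var x)    = eq x
rename-subst eq (ƛ t)      = cong ƛ_ (rename-subst (ext-exts eq) t)
rename-subst eq (t · u)    = cong₂ _·_ (rename-subst eq t) (rename-subst eq u)
rename-subst eq (t [← u ]) = cong₂ _[←_] (rename-subst (ext-exts eq) t) (rename-subst eq u)

subst-suc : ∀ t → subst (exts σ) (rename suc t) ≡ rename suc (subst σ t)
subst-suc t = trans (subst-rename (λ _ → refl) t) (sym (rename-subst (λ _ → refl) t))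

exts-∘ : (∀ x → subst τ (σ x) ≡ υ x) → ∀ x → subst (exts τ) (exts σ x) ≡ exts υ x
exts-∘         eq zero    = refl
exts-∘ {σ = σ} eq (suc x) = trans (subst-suc (σ x)) (cong (rename suc) (eq x))

subst-∘ : (∀ x → subst τ (σ x) ≡ υ x) → ∀ t → subst τ (subst σ t) ≡ subst υ t
subst-∘ eq (var x)    = eq x
subst-∘ eq (ƛ t)      = cong ƛ_ (subst-∘ (exts-∘ eq) t)
subst-∘ eq (t · u)    = cong₂ _·_ (subst-∘ eq t) (subst-∘ eq u)
subst-∘ eq (t [← u ]) = cong₂ _[←_] (subst-∘ (exts-∘ eq) t) (subst-∘ eq u)

rename-suc-⟦⟧ : ∀ t u → rename suc t ⟦ u ⟧ ≡ t
rename-suc-⟦⟧ t u = trans (subst-rename (λ _ → refl) t) (subst-id (λ _ → refl) t)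

infixr 5 _•_

_•_ : Term → (ℕ → Term) → ℕ → Term
(u • σ) zero    = u
(u • σ) (suc x) = σ x

-- Firing a redex whose body already carries `σ` gives one simultaneous substitution, so the
-- induction on normal forms only ever extends `σ`.
subst-exts-⟦⟧ : ∀ t u → subst (exts σ) t ⟦ u ⟧ ≡ subst (u • σ) t
subst-exts-⟦⟧ {σ} t u = subst-∘ eq t
  where
  eq : ∀ x → subst (single u) (exts σ x) ≡ (u • σ) x
  eq zero    = refl
  eq (suc x) = rename-suc-⟦⟧ (σ x) u

exts-cong-< : (∀ {x} → x < n → σ x ≡ τ x) → ∀ {x} → x < n → exts σ x ≡ exts τ x
exts-cong-< eq {zero}  _   = refl
exts-cong-< eq {suc x} x<n = cong (rename suc) (eq (≤-trans (m≤n+m _ 1) x<n))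

-- A head context binds only finitely many variables; this lets it imitate a constant substitution.
finite-support : ∀ t → ∃[ n ] (∀ {σ τ} → (∀ {x} → x < n → σ x ≡ τ x) → subst σ t ≡ subst τ t)
finite-support (var x) = suc x , λ eq → eq ≤-refl
finite-support (ƛ t) with n , f ← finite-support t =
  n , λ eq → cong ƛ_ (f (exts-cong-< eq))
finite-support (t · u) with n₁ , f ← finite-support t | n₂ , g ← finite-support u =
  n₁ ⊔ n₂ , λ eq → cong₂ _·_
    (f λ x<n → eq (<-≤-trans x<n (m≤m⊔n n₁ n₂)))
    (g λ x<n → eq (<-≤-trans x<n (m≤n⊔m n₁ n₂)))
finite-support (t [← u ]) with n₁ , f ← finite-support t | n₂ , g ← finite-support u =
  n₁ ⊔ n₂ , λ eq → cong₂ _[←_]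
    (f (exts-cong-< λ x<n → eq (<-≤-trans x<n (m≤m⊔n n₁ n₂))))
    (g λ x<n → eq (<-≤-trans x<n (m≤n⊔m n₁ n₂)))

-- Closure properties of reduction

Root : Term → Term → Set
Root = _↦m_ ∪ _↦e_

root : Root t u → t →vsc u
root = close ⟨·⟩

·ˡ-cong : t →vsc t′ → t · u →vsc t′ · u
·ˡ-cong (close F r) = close (F ·ˡ _) r

·ʳ-cong : u →vsc u′ → t · u →vsc t · u′
·ʳ-cong (close F r) = close (_ ·ʳ F) r

ƛ-cong : t →vsc t′ → ƛ t →vsc ƛ t′
ƛ-cong (close F r) = close (ƛ F) r

[←]ˡ-cong : t →vsc t′ → t [← u ] →vsc t′ [← u ]
[←]ˡ-cong (close F r) = close (F [← _ ]ˡ) r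

[←]ʳ-cong : u →vsc u′ → t [← u ] →vsc t [← u′ ]
[←]ʳ-cong (close F r) = close (_ [← F ]ʳ) r

-- The accumulator follows the outside-in descent of `renameˢ`, so `rename-⟨⟩ˢ` needs no commutation
-- of `ext` with its iterates.
ext^ : ℕ → (ℕ → ℕ) → ℕ → ℕ
ext^ zero    ρ = ρ
ext^ (suc n) ρ = ext^ n (ext ρ)

ext^-+ : ∀ ρ n x → ext^ n ρ (n + x) ≡ n + ρ x
ext^-+ ρ zero    x = refl
ext^-+ ρ (suc n) x = begin
  ext^ n (ext ρ) (suc (n + x))  ≡⟨ cong (ext^ n (ext ρ)) (+-suc n x) ⟨
  ext^ n (ext ρ) (n + suc x)    ≡⟨ ext^-+ (ext ρ) n (suc x) ⟩
  n + suc (ρ x)                 ≡⟨ +-suc n (ρ x) ⟩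
  suc (n + ρ x)                 ∎
  where open ≡-Reasoning

renameˢ : (ℕ → ℕ) → SubCtx → SubCtx
renameˢ ρ ⟨·⟩        = ⟨·⟩
renameˢ ρ (L [← u ]) = renameˢ (ext ρ) L [← rename ρ u ]

depth-renameˢ : ∀ ρ L → depth (renameˢ ρ L) ≡ depth L
depth-renameˢ ρ ⟨·⟩        = refl
depth-renameˢ ρ (L [← _ ]) = cong suc (depth-renameˢ (ext ρ) L)

rename-⟨⟩ˢ : ∀ ρ L t → rename ρ (L ⟨ t ⟩ˢ) ≡ renameˢ ρ L ⟨ rename (ext^ (depth L) ρ) t ⟩ˢ
rename-⟨⟩ˢ ρ ⟨·⟩        t = refl
rename-⟨⟩ˢ ρ (L [← u ]) t = cong (_[← rename ρ u ]) (rename-⟨⟩ˢ (ext ρ) L t)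

rename-shift : ∀ ρ L u → rename (ext^ (depth L) ρ) (rename (depth L +_) u)
                       ≡ rename (depth (renameˢ ρ L) +_) (rename ρ u)
rename-shift ρ L u rewrite depth-renameˢ ρ L =
  trans (rename-∘ (ext^-+ ρ (depth L)) u) (sym (rename-∘ (λ _ → refl) u))

rename-ext-shift : ∀ ρ L t → rename (ext (ext^ (depth L) ρ)) (rename (ext (depth L +_)) t)
                           ≡ rename (ext (depth (renameˢ ρ L) +_)) (rename (ext ρ) t)
rename-ext-shift ρ L t rewrite depth-renameˢ ρ L =
  trans (rename-∘ (ext-∘ (ext^-+ ρ (depth L))) t) (sym (rename-∘ (ext-∘ (λ _ → refl)) t))

rename-⟦⟧ : ∀ ρ t u → rename ρ (t ⟦ u ⟧) ≡ rename (ext ρ) t ⟦ rename ρ u ⟧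
rename-⟦⟧ ρ t u = trans (rename-subst (λ _ → refl) t) (sym (subst-rename eq t))
  where
  eq : ∀ x → single (rename ρ u) (ext ρ x) ≡ rename ρ (single u x)
  eq zero    = refl
  eq (suc x) = refl

rename-value : Value v → Value (rename ρ v)
rename-value (var x) = var _
rename-value (ƛ t)   = ƛ _

-- `abstr` renames what it binds, so reduction inside a head context needs steps to be stable under
-- renaming. By `ext^-+`, extending `ρ` under `L` commutes with the shift by `depth L`.
rename-root : ∀ ρ → Root t u → Root (rename ρ t) (rename ρ u)
rename-root ρ (inj₁ (mult L t u)) =
  inj₁ (subst₂ _↦m_
    (cong (_· rename ρ u) (sym (rename-⟨⟩ˢ ρ L (ƛ t))))
    (sym (trans (rename-⟨⟩ˢ ρ L (t [← rename (depth L +_) u ]))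
                (cong (λ s → renameˢ ρ L ⟨ rename (ext (ext^ (depth L) ρ)) t [← s ] ⟩ˢ)
                      (rename-shift ρ L u))))
    (mult (renameˢ ρ L) (rename (ext (ext^ (depth L) ρ)) t) (rename ρ u)))
rename-root ρ (inj₂ (expo L t {v} val)) =
  inj₂ (subst₂ _↦e_
    (cong (rename (ext ρ) t [←_]) (sym (rename-⟨⟩ˢ ρ L v)))
    (sym (trans (rename-⟨⟩ˢ ρ L (rename (ext (depth L +_)) t ⟦ v ⟧))
                (cong (renameˢ ρ L ⟨_⟩ˢ)
                      (trans (rename-⟦⟧ ρᴸ (rename (ext (depth L +_)) t) v)
                             (cong (_⟦ rename ρᴸ v ⟧) (rename-ext-shift ρ L t))))))
    (expo (renameˢ ρ L) (rename (ext ρ) t) (rename-value val)))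
  where ρᴸ = ext^ (depth L) ρ

rename-⟨⟩ᶠ : ∀ ρ F → Root t u → rename ρ (F ⟨ t ⟩ᶠ) →vsc rename ρ (F ⟨ u ⟩ᶠ)
rename-⟨⟩ᶠ ρ ⟨·⟩         r = root (rename-root ρ r)
rename-⟨⟩ᶠ ρ (F ·ˡ _)    r = ·ˡ-cong (rename-⟨⟩ᶠ ρ F r)
rename-⟨⟩ᶠ ρ (_ ·ʳ F)    r = ·ʳ-cong (rename-⟨⟩ᶠ ρ F r)
rename-⟨⟩ᶠ ρ (ƛ F)       r = ƛ-cong (rename-⟨⟩ᶠ (ext ρ) F r)
rename-⟨⟩ᶠ ρ (F [← _ ]ˡ) r = [←]ˡ-cong (rename-⟨⟩ᶠ (ext ρ) F r)
rename-⟨⟩ᶠ ρ (_ [← F ]ʳ) r = [←]ʳ-cong (rename-⟨⟩ᶠ ρ F r)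

abstr-cong : ∀ x → t →vsc u → abstr x t →vsc abstr x u
abstr-cong x (close F r) = ƛ-cong (rename-⟨⟩ᶠ (bind x) F r)

⟨⟩ʰ-cong : ∀ H → t →vsc* u → H ⟨ t ⟩ʰ →vsc* H ⟨ u ⟩ʰ
⟨⟩ʰ-cong ⟨·⟩       rs = rs
⟨⟩ʰ-cong (ƛ x ∙ H) rs = gmap (abstr x) (abstr-cong x) (⟨⟩ʰ-cong H rs)
⟨⟩ʰ-cong (H · u)   rs = gmap (_· u) ·ˡ-cong (⟨⟩ʰ-cong H rs)

infixr 9 _∘ʰ_

_∘ʰ_ : HeadCtx → HeadCtx → HeadCtx
⟨·⟩       ∘ʰ H′ = H′
(ƛ x ∙ H) ∘ʰ H′ = ƛ x ∙ (H ∘ʰ H′)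
(H · u)   ∘ʰ H′ = (H ∘ʰ H′) · u

∘ʰ-⟨⟩ʰ : ∀ H H′ t → (H ∘ʰ H′) ⟨ t ⟩ʰ ≡ H ⟨ H′ ⟨ t ⟩ʰ ⟩ʰ
∘ʰ-⟨⟩ʰ ⟨·⟩       H′ t = refl
∘ʰ-⟨⟩ʰ (ƛ x ∙ H) H′ t = cong (abstr x) (∘ʰ-⟨⟩ʰ H H′ t)
∘ʰ-⟨⟩ʰ (H · u)   H′ t = cong (_· u) (∘ʰ-⟨⟩ʰ H H′ t)

⟦⟧-step : ∀ t → Value v → t [← v ] →vsc t ⟦ v ⟧
⟦⟧-step {v} t val =
  -- Even with `L` empty the rule shifts `t`, by `ext (0 +_)`, which is the identity only pointwise.
  root (inj₂ (transport (λ s → t [← v ] ↦e s ⟦ v ⟧) (rename-id (ext-id λ _ → refl) t)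
                        (expo ⟨·⟩ t val)))

β-value : ∀ t → Value v → (ƛ t) · v →vsc* t ⟦ v ⟧
β-value {v} t val =
  root (inj₁ (transport (λ s → (ƛ t) · v ↦m t [← s ]) (rename-id (λ _ → refl) v)
                        (mult ⟨·⟩ t v)))
  ◅ ⟦⟧-step t val ◅ ε

-- Full normal forms

-- Normal strictly contains the full normal forms: the values L⟨x⟩ count as stuck,
-- so that t [← L⟨x⟩] is not excluded although _↦e_ applies to it.

data Normal : Term → Set
data Abs    : Term → Set
data Stuck  : Term → Set

data Normal where
  abs   : Abs t → Normal t
  stuck : Stuck t → Normal t

data Abs where
  ƛ_    : Normal t → Abs (ƛ t)
  _[←_] : Abs t → Stuck u → Abs (t [← u ])

data Stuck where
  var   : ∀ x → Stuck (var x)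
  _·_   : Stuck t → Normal u → Stuck (t · u)
  _[←_] : Stuck t → Stuck u → Stuck (t [← u ])

abs-shape : Abs t → ∃[ L ] ∃[ s ] L ⟨ ƛ s ⟩ˢ ≡ t
abs-shape (ƛ_ {t} _) = ⟨·⟩ , t , refl
abs-shape (_[←_] {u = u} a _) with L , s , refl ← abs-shape a = L [← u ] , s , refl

-- An `Abs` exposes an abstraction under a substitution context, so in function position or as the
-- content of an explicit substitution it would create a root redex; only `Stuck` survives there.
fullNormal⇒normal : ∀ t → FullNormal t → Normal t
fullNormal⇒normal (var x) nf = stuck (var x)
fullNormal⇒normal (ƛ t)   nf = abs (ƛ fullNormal⇒normal t λ (_ , r) → nf (_ , ƛ-cong r))
fullNormal⇒normal (t · u) nf
  with fullNormal⇒normal t (λ (_ , r) → nf (_ , ·ˡ-cong r))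
... | abs a with L , s , refl ← abs-shape a = contradiction (_ , root (inj₁ (mult L s u))) nf
... | stuck h = stuck (h · fullNormal⇒normal u λ (_ , r) → nf (_ , ·ʳ-cong r))
fullNormal⇒normal (t [← u ]) nf
  with fullNormal⇒normal t (λ (_ , r) → nf (_ , [←]ˡ-cong r))
     | fullNormal⇒normal u (λ (_ , r) → nf (_ , [←]ʳ-cong r))
... | _       | abs a with L , s , refl ← abs-shape a =
  contradiction (_ , root (inj₂ (expo L t (ƛ s)))) nf
... | abs a   | stuck h = abs (a [← h ])
... | stuck g | stuck h = stuck (g [← h ])

I-fullNormal : FullNormal I
I-fullNormal (_ , step) = irreducible step refl
  where
  irreducible : t →vsc u → t ≢ I
  irreducible (close ⟨·⟩ (inj₁ (mult _ _ _)))     ()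
  irreducible (close ⟨·⟩ (inj₂ (expo _ _ _)))     ()
  irreducible (close (ƛ ⟨·⟩) (inj₁ (mult _ _ _))) ()
  irreducible (close (ƛ ⟨·⟩) (inj₂ (expo _ _ _))) ()

-- Evaluation of normal forms under the erasing substitution

eraser : ℕ → Term
eraser zero    = I
eraser (suc n) = ƛ eraser n

eraser-value : ∀ n → Value (eraser n)
eraser-value zero    = ƛ _
eraser-value (suc n) = ƛ _

subst-eraser : ∀ σ n → subst σ (eraser n) ≡ eraser n
subst-eraser σ zero    = refl
subst-eraser σ (suc n) = cong ƛ_ (subst-eraser (exts σ) n)

eraser-· : ∀ n → Value v → eraser (suc n) · v →vsc* eraser n
eraser-· {v} n val =
  transport (eraser (suc n) · v →vsc*_) (subst-eraser (single v) n) (β-value (eraser n) val)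

-- Only a lower bound is recorded: an explicit substitution that fires hands its variable an eraser
-- of unknown height.
AtLeast : ℕ → Term → Set
AtLeast n t = ∃[ k ] (n ≤ k × t ≡ eraser k)

Erasing : ℕ → (ℕ → Term) → Set
Erasing n σ = ∀ x → AtLeast n (σ x)

erasing-mono : m ≤ n → Erasing n σ → Erasing m σ
erasing-mono m≤n er x with k , n≤k , eq ← er x = k , ≤-trans m≤n n≤k , eq

erasing-• : n ≤ k → Erasing n σ → Erasing n (eraser k • σ)
erasing-• {k = k} n≤k er zero    = k , n≤k , refl
erasing-•         n≤k er (suc x) = er x

foldl-·-cong : ∀ us → t →vsc* u → foldl _·_ t us →vsc* foldl _·_ u us
foldl-·-cong []       rs = rs
foldl-·-cong (u ∷ us) rs = foldl-·-cong us (gmap (_· u) ·ˡ-cong rs)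

Solves : List Term → Term → Set
Solves us t = foldl _·_ t us →vsc* I

eraser-solvable : ∀ n → ∃[ us ] Solves us (eraser n)
eraser-solvable zero    = [] , ε
eraser-solvable (suc n) with us , rs ← eraser-solvable n =
  I ∷ us , foldl-·-cong us (eraser-· n (ƛ _)) ◅◅ rs

-- Both outcomes feed the induction: a value can be erased by a stuck head, while `args` drives the
-- term itself on to `I`.
record Evaluates (t : Term) : Set where
  constructor evaluates
  field
    {value}   : Term
    args      : List Term
    isValue   : Value value
    reduction : t →vsc* value
    solved    : Solves args value

open Evaluates

evaluates-◅◅ : t →vsc* u → Evaluates u → Evaluates t
evaluates-◅◅ rs (evaluates us val rs′ sol) = evaluates us val (rs ◅◅ rs′) sol

eraser-evaluates : ∀ n → Evaluates (eraser n)
eraser-evaluates n with us , sol ← eraser-solvable n = evaluates us (eraser-value n) ε sol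

subst-es : ∀ σ t u k → subst σ u →vsc* eraser k →
           subst σ (t [← u ]) →vsc* subst (eraser k • σ) t
subst-es σ t u k rs =
  gmap (subst (exts σ) t [←_]) [←]ʳ-cong rs
  ◅◅ transport (subst (exts σ) t [← eraser k ] →vsc_) (subst-exts-⟦⟧ t (eraser k))
               (⟦⟧-step (subst (exts σ) t) (eraser-value k))
  ◅ ε

-- Here `n` pays for the abstractions lost during evaluation and `m` is the surplus demanded of the
-- result. As `n` is fixed before `m`, each caller can ask for the surplus it needs.
StuckBound : Term → ℕ → Set
StuckBound t n = ∀ m {σ} → Erasing (n + m) σ → ∃[ k ] (m ≤ k × subst σ t →vsc* eraser k)

NormalBound : Term → ℕ → Set
NormalBound t n = ∀ {σ} → Erasing n σ → Evaluates (subst σ t)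

normal-bound : Normal t → ∃[ n ] NormalBound t n
abs-bound    : Abs t → ∃[ n ] NormalBound t n
stuck-bound  : Stuck t → ∃[ n ] StuckBound t n

normal-bound (abs a)   = abs-bound a
normal-bound (stuck h) with n , f ← stuck-bound h = n + 0 , λ er →
  let k , _ , rs = f 0 er in evaluates-◅◅ rs (eraser-evaluates k)

abs-bound (ƛ_ {t} nf) with n , f ← normal-bound nf = n , λ {σ} er →
  let ev = f (erasing-• ≤-refl er)
  -- The first argument `eraser n` is just tall enough for the body's extended substitution to stay
  -- erasing at level `n`.
  in evaluates (eraser n ∷ args ev) (ƛ _) ε
       (foldl-·-cong (args ev)
         (transport ((ƛ subst (exts σ) t) · eraser n →vsc*_) (subst-exts-⟦⟧ t (eraser n))
                    (β-value (subst (exts σ) t) (eraser-value n))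
          ◅◅ reduction ev)
        ◅◅ solved ev)
abs-bound (_[←_] {t} {u} a h) with n₁ , f ← abs-bound a | n₂ , g ← stuck-bound h =
  n₂ + n₁ , λ {σ} er →
    let k , n₁≤k , rs = g n₁ er
    in evaluates-◅◅ (subst-es σ t u k rs)
         (f (erasing-• n₁≤k (erasing-mono (m≤n+m n₁ n₂) er)))

stuck-bound (var x) = 0 , λ m er →
  let k , m≤k , eq = er x in k , m≤k , transport (_→vsc* eraser k) (sym eq) ε
stuck-bound (_·_ {t} {u} h nf) with n₁ , f ← stuck-bound h | n₂ , g ← normal-bound nf =
  -- The sum dominates both needs: `n₂` for the argument, and for the head `n₁` plus a surplus of
  -- `suc m`, one abstraction of which is spent on the argument.
  n₂ + suc n₁ , λ m er →
    apply (f (suc m) (erasing-mono (bound m) er))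
          (g (erasing-mono (m+n≤o⇒m≤o n₂ (≤-reflexive (sym (+-assoc n₂ (suc n₁) m)))) er))
  where
  bound : ∀ m → n₁ + suc m ≤ n₂ + suc n₁ + m
  bound m = ≤-trans (≤-reflexive (+-suc n₁ m)) (+-monoˡ-≤ m (m≤n+m (suc n₁) n₂))

  apply : ∃[ k ] (m < k × subst σ t →vsc* eraser k) → Evaluates (subst σ u) →
          ∃[ k ] (m ≤ k × subst σ (t · u) →vsc* eraser k)
  apply {σ = σ} (suc k , s≤s m≤k , rs) ev =
    k , m≤k , gmap (_· subst σ u) ·ˡ-cong rs
              ◅◅ gmap (eraser (suc k) ·_) ·ʳ-cong (reduction ev)
              ◅◅ eraser-· k (isValue ev)
stuck-bound (_[←_] {t} {u} h₁ h₂) with n₁ , f ← stuck-bound h₁ | n₂ , g ← stuck-bound h₂ =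
  n₂ + n₁ , λ m {σ} er →
    -- The eraser that replaces the bound variable must itself reach the level `n₁ + m` required by
    -- `t`, so that surplus is asked of `u`.
    let k , n₁+m≤k , rs = g (n₁ + m) (erasing-mono (≤-reflexive (sym (+-assoc n₂ n₁ m))) er)
        l , m≤l , rs′   = f m (erasing-• n₁+m≤k
                            (erasing-mono (+-monoˡ-≤ m (m≤n+m n₁ n₂)) er))
    in l , m≤l , subst-es σ t u k rs ◅◅ rs′

-- Closing a term by a head context

-- `single v ∘ bind n` substitutes `v` for the name `n` and keeps every other name. The rounds
-- follow the order in which `closing` is fired, innermost binder first.
fill : Term → ℕ → ℕ → Term
fill v zero    = var
fill v (suc n) = subst (single v ∘ bind n) ∘ fill v n

fill-≥ : ∀ v n {x} → n ≤ x → fill v n x ≡ var x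
fill-≥ v zero        n≤x = refl
fill-≥ v (suc n) {x} n<x
  rewrite fill-≥ v n (<⇒≤ n<x) | dec-false (x ≟ n) (>⇒≢ n<x) = refl

fill-< : ∀ k n {x} → x < n → fill (eraser k) n x ≡ eraser k
fill-< k (suc n) x<1+n with m<1+n⇒m<n∨m≡n x<1+n
-- `eraser k` is closed, so the round for the name `n` leaves earlier fillings intact.
... | inj₁ x<n rewrite fill-< k n x<n = subst-eraser _ k
... | inj₂ refl rewrite fill-≥ (eraser k) n ≤-refl | dec-true (n ≟ n) refl = refl

closing : Term → ℕ → HeadCtx
closing v zero    = ⟨·⟩
closing v (suc n) = (ƛ n ∙ closing v n) · v

closing-fills : Value v → ∀ n t → closing v n ⟨ t ⟩ʰ →vsc* subst (fill v n) t
closing-fills     val zero    t = transport (t →vsc*_) (sym (subst-id (λ _ → refl) t)) ε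
closing-fills {v} val (suc n) t =
  ⟨⟩ʰ-cong ((ƛ n ∙ ⟨·⟩) · v) (closing-fills val n t)
  ◅◅ transport (abstr n (subst (fill v n) t) · v →vsc*_)
       (trans (subst-rename (λ _ → refl) (subst (fill v n) t)) (subst-∘ (λ _ → refl) t))
       (β-value _ val)

applying : List Term → HeadCtx → HeadCtx
applying us H = foldl _·_ H us

applying-⟨⟩ʰ : ∀ us H t → applying us H ⟨ t ⟩ʰ ≡ foldl _·_ (H ⟨ t ⟩ʰ) us
applying-⟨⟩ʰ []       H t = refl
applying-⟨⟩ʰ (u ∷ us) H t = applying-⟨⟩ʰ us (H · u) t

normal-solvable : Normal t → SOL-ID t
normal-solvable {t} nf with k , bound ← normal-bound nf | n , agree ← finite-support t
  -- The constant substitution is erasing at level `k`. The head context imitates it only below `n`,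
  -- which by `agree` is all that matters for `t`.
  with ev ← bound {λ _ → eraser k} (λ _ → k , ≤-refl , refl) =
  applying (args ev) H , transport (_→vsc* I) (sym (applying-⟨⟩ʰ (args ev) H t))
    (foldl-·-cong (args ev) (closes ◅◅ reduction ev) ◅◅ solved ev)
  where
  H = closing (eraser k) n

  closes : H ⟨ t ⟩ʰ →vsc* subst (λ _ → eraser k) t
  closes = transport (H ⟨ t ⟩ʰ →vsc*_) (agree (fill-< k n))
                     (closing-fills (eraser-value k) n t)

-- Equivalence of the three properties

ex⇒id : SOL-EX t → SOL-ID t
ex⇒id {t} (u , H , nf , rs) with H′ , rs′ ← normal-solvable (fullNormal⇒normal u nf) =
  -- `H′` is built from `u` but wrapped around `H`; the reduction to `u` takes place inside it
  -- first.
  H′ ∘ʰ H , transport (_→vsc* I) (sym (∘ʰ-⟨⟩ʰ H′ H t)) (⟨⟩ʰ-cong H′ rs ◅◅ rs′)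

id⇒ex : SOL-ID t → SOL-EX t
id⇒ex (H , rs) = I , H , I-fullNormal , rs

-- A normal form u need not be a value, so I u may fail to reduce to u; it is
-- thunked and passed as λz.u instead.
id⇒fe : SOL-ID t → SOL-FE t
id⇒fe (H , rs) u _ =
  (H · (ƛ rename suc u)) · I ,
  gmap (λ s → (s · (ƛ rename suc u)) · I) (·ˡ-cong ∘ ·ˡ-cong) rs
  ◅◅ gmap (_· I) ·ˡ-cong (β-value (var 0) (ƛ _))
  ◅◅ transport ((ƛ rename suc u) · I →vsc*_) (rename-suc-⟦⟧ u I) (β-value (rename suc u) (ƛ _))

fe⇒id : SOL-FE t → SOL-ID t
fe⇒id fe = fe I I-fullNormal

theorem5p5 : (t : Term) → (SOL-EX t ⇔ SOL-ID t) × (SOL-ID t ⇔ SOL-FE t)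
theorem5p5 t = mk⇔ ex⇒id id⇒ex , mk⇔ id⇒fe fe⇒id
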